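{- Let $w_1,w_2,w_3$ be any odd positive integers. Then for every integer $n\ge 0$, \begin{align*} &\sum_{k+l+m=n}\binom{n}{k,l,m}T_k(w_1d-1,\chi)T_l(w_2d-1,\chi)T_m(w_3d-1,\chi)\,w_{3}^{k}w_{1}^{l}w_{2}^{m}\\ =&\sum_{k+l+m=n}\binom{n}{k,l,m}T_k(w_1d-1,\chi)T_l(w_3d-1,\chi)T_m(w_2d-1,\chi)\,w_{2}^{k}w_{1}^{l}w_{3}^{m}. \end{align*} Here each sum is over all nonnegative integers $k,l,m$ with $k+l+m=n$.
   Context: $p$ is a fixed odd prime and $\mathbb{C}_p$ is the completion of an algebraic closure of $\mathbb{Q}_p$. $d$ is a fixed odd positive integer and $\chi$ is a (primitive) Dirichlet character of conductor $d$, with values in $\overline{\mathbb{Q}}$, regarded as $\mathbb{C}_p$-valued through a fixed embedding $\overline{\mathbb{Q}}\to\mathbb{C}_p$; as usual $\chi(a)=0$ when $\gcd(a,d)>1$ (and $\chi\equiv 1$ if $d=1$). For integers $k,n\ge 0$, the $k$th alternating generalized power sum attached to $\chi$ is $T_k(n,\chi)=\sum_{a=0}^{n}(-1)^a\chi(a)a^k$, with the convention $0^0=1$. The multinomial coefficient is $\binom{n}{k,l,m}=\frac{n!}{k!\,l!\,m!}$. -}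

module Defs where

open import Algebra.Apartness.Bundles using (HeytingField; HeytingCommutativeRing)
open import Algebra.Bundles using (CommutativeRing; RawRing)
open import Algebra.Morphism.Structures using (IsRingMonomorphism)
import Algebra.Definitions.RawSemiring as RawSemiringDefs
import Algebra.Properties.Monoid.Sum as MonoidSum
open import Data.Fin.Base using (toℕ)
open import Data.Integer.Base as ℤ using (ℤ; +_)
import Data.Integer.Coprimality as ℤ
import Data.Integer.Divisibility as ℤ
open import Data.List.Base using (List; _∷_; foldr)
open import Data.List.Relation.Unary.All using (All)
open import Data.Nat.Base as ℕ using (ℕ; suc; _!; _∸_)
open import Data.Nat.DivMod using (_/_)
import Data.Nat.Divisibility as ℕ
open import Data.Nat.Properties using (_!≢0; _!*_!≢0; m*n≢0)
open import Data.Product.Base using (∃-syntax; _×_)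
open import Data.Rational.Base as ℚ using (ℚ; 1ℚ)
open import Level using (Level; _⊔_) renaming (suc to lsuc)
open import Relation.Binary.PropositionalEquality.Core using (_≡_)
open import Relation.Nullary.Negation.Core using (¬_)

Odd : ℕ → Set
Odd n = ∃[ k ] n ≡ 1 ℕ.+ 2 ℕ.* k

multinomial : (n k l m : ℕ) → ℕ
multinomial n k l m = _/_ (n !) (k ! ℕ.* l ! ℕ.* m !)
  {{m*n≢0 (k ! ℕ.* l !) (m !) {{k !* l !≢0}} {{m !≢0}}}}

module FieldNotions {c ℓ₁ ℓ₂ : Level} (F : HeytingField c ℓ₁ ℓ₂) where
  open HeytingField F public

  commutativeRing : CommutativeRing c ℓ₁
  commutativeRing = HeytingCommutativeRing.commutativeRing heytingCommutativeRing

  open CommutativeRing commutativeRing public using (rawRing; +-monoid)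
  open RawRing rawRing using (rawSemiring)
  open RawSemiringDefs rawSemiring public using (_^_)
  open RawSemiringDefs rawSemiring renaming (_×_ to _×ⁿ_) using ()
  open MonoidSum +-monoid public using (sum-syntax; sum⁺-syntax)

  fromℕ : ℕ → Carrier
  fromℕ n = n ×ⁿ 1#

  CharacteristicZero : Set ℓ₂
  CharacteristicZero = ∀ n → fromℕ (suc n) # 0#

  -- x = (a - b) / (1 + m); in characteristic zero these are the elements of ℚ.
  IsRational : Carrier → Set ℓ₁
  IsRational x = ∃[ a ] ∃[ b ] ∃[ m ] fromℕ (suc m) * x ≈ fromℕ a - fromℕ b

  -- monic (c₀ ∷ … ∷ cₙ₋₁ ∷ []) x = c₀ + c₁ x + … + cₙ₋₁ xⁿ⁻¹ + xⁿ
  monic : List Carrier → Carrier → Carrier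
  monic cs x = foldr (λ a r → a + x * r) 1# cs

  AlgebraicOver : ∀ {ℓ} → (Carrier → Set ℓ) → Carrier → Set (c ⊔ ℓ₁ ⊔ ℓ)
  AlgebraicOver K x = ∃[ cs ] All K cs × monic cs x ≈ 0#

  AlgebraicallyClosed : Set (c ⊔ ℓ₁)
  AlgebraicallyClosed = ∀ a cs → ∃[ x ] monic (a ∷ cs) x ≈ 0#

record AlgebraicClosureOfℚ (c ℓ₁ ℓ₂ : Level) : Set (lsuc (c ⊔ ℓ₁ ⊔ ℓ₂)) where
  field
    heytingField : HeytingField c ℓ₁ ℓ₂
  open FieldNotions heytingField public
  field
    characteristicZero  : CharacteristicZero
    algebraic           : ∀ x → AlgebraicOver IsRational x
    algebraicallyClosed : AlgebraicallyClosed

-- The completion of an algebraic closure of ℚₚ, presented by the properties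
-- that determine it up to isomorphism: a complete, algebraically closed valued
-- field extending (ℚ , vₚ), in which the elements algebraic over ℚₚ are dense.
-- The valuation is additive and normalised by v p = 1; its value group is then
-- ℚ, so that no real numbers are needed.
record ℂₚ (p : ℕ) (c ℓ₁ ℓ₂ : Level) : Set (lsuc (c ⊔ ℓ₁ ⊔ ℓ₂)) where
  field
    heytingField : HeytingField c ℓ₁ ℓ₂
  open FieldNotions heytingField public
  field
    characteristicZero : CharacteristicZero
    v      : ∀ x → x # 0# → ℚ
    v-cong : ∀ {x y} → x ≈ y → (x#0 : x # 0#) (y#0 : y # 0#) → v x x#0 ≡ v y y#0
    v-*    : ∀ {x y} (x#0 : x # 0#) (y#0 : y # 0#) (xy#0 : x * y # 0#) →
             v (x * y) xy#0 ≡ v x x#0 ℚ.+ v y y#0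
    v-+    : ∀ {x y} (x#0 : x # 0#) (y#0 : y # 0#) (x+y#0 : x + y # 0#) →
             v x x#0 ℚ.⊓ v y y#0 ℚ.≤ v (x + y) x+y#0
    v-p    : (p#0 : fromℕ p # 0#) → v (fromℕ p) p#0 ≡ 1ℚ

  -- v (x - y) ≥ N, where v 0 = ∞.
  Close : ℕ → Carrier → Carrier → Set ℓ₂
  Close N x y = (x-y#0 : x - y # 0#) → (+ N) ℚ./ 1 ℚ.≤ v (x - y) x-y#0

  Cauchy : (ℕ → Carrier) → Set ℓ₂
  Cauchy s = ∀ N → ∃[ M ] ∀ i j → M ℕ.≤ i → M ℕ.≤ j → Close N (s i) (s j)

  _ConvergesTo_ : (ℕ → Carrier) → Carrier → Set ℓ₂
  s ConvergesTo x = ∀ N → ∃[ M ] ∀ i → M ℕ.≤ i → Close N (s i) x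

  -- ℚₚ, as the topological closure of ℚ.
  Is-ℚₚ : Carrier → Set (c ⊔ ℓ₁ ⊔ ℓ₂)
  Is-ℚₚ x = ∀ N → ∃[ q ] IsRational q × Close N x q

  field
    algebraicallyClosed : AlgebraicallyClosed
    complete            : ∀ s → Cauchy s → ∃[ x ] s ConvergesTo x
    algebraic-dense     : ∀ x N → ∃[ y ] AlgebraicOver Is-ℚₚ y × Close N x y

-- Extended by zero to all of ℤ.
record PrimitiveDirichletCharacter {c ℓ₁ ℓ₂ : Level} (F : HeytingField c ℓ₁ ℓ₂)
                                   (d : ℕ) : Set (c ⊔ ℓ₁) where
  open HeytingField F
  field
    χ          : ℤ → Carrier
    χ-1        : χ (+ 1) ≈ 1#
    χ-*        : ∀ a b → χ (a ℤ.* b) ≈ χ a * χ b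
    χ-periodic : ∀ a → χ (a ℤ.+ + d) ≈ χ a
    χ-zero     : ∀ a → ¬ ℤ.Coprime a (+ d) → χ a ≈ 0#
    -- The conductor is d: no proper divisor e of d has the property that χ is
    -- trivial on the units congruent to 1 modulo e.
    conductor  : ∀ e → e ℕ.∣ d →
                 (∀ a → ℤ.Coprime a (+ d) → (+ e) ℤ.∣ (a ℤ.- + 1) → χ a ≈ 1#) →
                 e ≡ d

record Embedding {a b₁ b₂ c ℓ₁ ℓ₂ : Level} {p : ℕ}
                 (ℚ̄ : AlgebraicClosureOfℚ a b₁ b₂) (Cₚ : ℂₚ p c ℓ₁ ℓ₂) :
                 Set (a ⊔ b₁ ⊔ c ⊔ ℓ₁) where
  private
    module ℚ̄ = AlgebraicClosureOfℚ ℚ̄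
    module Cₚ = ℂₚ Cₚ
  field
    ⟦_⟧                : ℚ̄.Carrier → Cₚ.Carrier
    isRingMonomorphism : IsRingMonomorphism ℚ̄.rawRing Cₚ.rawRing ⟦_⟧

module PowerSums {a b₁ b₂ c ℓ₁ ℓ₂ : Level} {p d : ℕ}
                 (ℚ̄ : AlgebraicClosureOfℚ a b₁ b₂) (Cₚ : ℂₚ p c ℓ₁ ℓ₂)
                 (ι : Embedding ℚ̄ Cₚ)
                 (X : PrimitiveDirichletCharacter (AlgebraicClosureOfℚ.heytingField ℚ̄) d)
                 where
  open ℂₚ Cₚ public
    using (Carrier; _≈_; _+_; _*_; -_; 1#; _^_; fromℕ; sum⁺-syntax)
  open Embedding ι using (⟦_⟧)
  open PrimitiveDirichletCharacter X using (χ)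

  -- T k n is Tₖ(n , χ); note that x ^ 0 = 1# for every x, including 0#.
  T : ℕ → ℕ → Carrier
  T k n = ∑[ i ≤ n ]
    ((- 1#) ^ toℕ i * ⟦ χ (+ toℕ i) ⟧ * fromℕ (toℕ i) ^ k)

  -- The sum of f k l m over all k, l, m with k + l + m = n.
  ∑₃ : ℕ → (ℕ → ℕ → ℕ → Carrier) → Carrier
  ∑₃ n f = ∑[ k ≤ n ] ∑[ l ≤ n ∸ toℕ k ]
    f (toℕ k) (toℕ l) (n ∸ toℕ k ∸ toℕ l)

{-# OPTIONS --safe #-}
module Submission where

-- Write τ for the shift of functions ℕ → Cₚ and ε(a) = (-1)ᵃχ(a), so that
-- ε(a + d) = -ε(a).  By the binomial theorem the left-hand side is the value
-- at 0 of Λ(w₁d , w₃) Λ(w₂d , w₁) Λ(w₃d , w₂) applied to y ↦ yⁿ, where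
-- Λ(m , s) = Σ_{a<m} ε(a) τ^{sa}.  Antiperiodicity gives
-- Λ(wd , s) (1 + τ^{sd}) = Λ(d , s) (1 + τ^{swd}), so after composition with
-- the product of the 1 + τ^{wᵢd} the operator is visibly symmetric in w₂, w₃.
-- That factor may be cancelled on the right because each 1 + τᵘ, u > 0, is
-- surjective; this replaces the division by e^{wᵢdt} + 1 in power series.

open import Defs
open import Level using (Level; _⊔_)
open import Data.Nat.Base using (ℕ; _∸_) renaming (_*_ to _*ℕ_)
open import Data.Nat.Primality using (Prime)
open import Algebra.Bundles using (CommutativeMonoid; CommutativeRing)
open import Algebra.Morphism.Structures using (IsRingMonomorphism)
import Algebra.Properties.AbelianGroup
import Algebra.Properties.CommutativeSemigroup
import Algebra.Properties.CommutativeSemiring.Binomial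
import Algebra.Properties.CommutativeSemiring.Exp
import Algebra.Properties.Ring
import Algebra.Properties.Semiring.Mult
import Algebra.Properties.Semiring.Sum
import Algebra.Solver.CommutativeMonoid
open import Data.Fin.Base using (Fin; toℕ) renaming (suc to fsuc)
open import Data.Fin.Properties using (toℕ≤pred[n])
open import Data.Integer.Base using (+_)
open import Data.Nat.Base as ℕ using (zero; suc; NonZero; _!; _≤_; _/_; _%_)
open import Data.Nat.Combinatorics using (_C_; nCk≡n!/k![n-k]!; k![n∸k]!∣n!)
open import Data.Nat.DivMod
  using (/-congˡ; m/n*n≡m; m*n/n≡m; m≡m%n+[m/n]*n; [m+n]%n≡m%n; m/n≡1+[m∸n]/n)
open import Data.Nat.Properties as ℕ using (_!≢0; _!*_!≢0; m*n≢0)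
open import Data.Product.Base using (∃-syntax; _,_)
open import Function.Base using (_∘_)
open import Relation.Binary.PropositionalEquality as ≡ using (_≡_)
import Relation.Binary.Reasoning.Setoid

-- Multinomial coefficients as products of binomial coefficients.

nCk*k!*[n∸k]!≡n! : ∀ {n k} → k ≤ n → (n C k) *ℕ (k ! *ℕ (n ∸ k) !) ≡ n !
nCk*k!*[n∸k]!≡n! {n} {k} k≤n = ≡.trans
  (≡.cong (_*ℕ (k ! *ℕ (n ∸ k) !)) (nCk≡n!/k![n-k]! k≤n))
  (m/n*n≡m (k![n∸k]!∣n! k≤n))
  where instance _ = k !* (n ∸ k) !≢0

-- Splitting n! into a binomial coefficient and two factorials, twice, shows that the floor division
-- in `multinomial` is exact. The product on the right is what two nested binomial expansions
-- produce.
multinomial≡C*C : ∀ {n k l} → k ≤ n → l ≤ n ∸ k →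
  multinomial n k l (n ∸ k ∸ l) ≡ (n C k) *ℕ ((n ∸ k) C l)
multinomial≡C*C {n} {k} {l} k≤n l≤n∸k = ≡.trans
  (/-congˡ {{k!*l!*m!≢0}} n!≡)
  (m*n/n≡m ((n C k) *ℕ ((n ∸ k) C l)) (k ! *ℕ l ! *ℕ m !) {{k!*l!*m!≢0}})
  where
  m = n ∸ k ∸ l
  k!*l!*m!≢0 : NonZero (k ! *ℕ l ! *ℕ m !)
  k!*l!*m!≢0 = m*n≢0 (k ! *ℕ l !) (m !) {{k !* l !≢0}} {{m !≢0}}
  open Algebra.Properties.CommutativeSemigroup ℕ.*-commutativeSemigroup using (x∙yz≈y∙xz)
  open ≡.≡-Reasoning
  n!≡ : n ! ≡ (n C k) *ℕ ((n ∸ k) C l) *ℕ (k ! *ℕ l ! *ℕ m !)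
  n!≡ = begin
    n !                                                  ≡⟨ nCk*k!*[n∸k]!≡n! k≤n ⟨
    (n C k) *ℕ (k ! *ℕ (n ∸ k) !)                        ≡⟨ ≡.cong (λ z → (n C k) *ℕ (k ! *ℕ z)) (nCk*k!*[n∸k]!≡n! l≤n∸k) ⟨
    (n C k) *ℕ (k ! *ℕ (((n ∸ k) C l) *ℕ (l ! *ℕ m !)))  ≡⟨ ≡.cong ((n C k) *ℕ_) (x∙yz≈y∙xz (k !) ((n ∸ k) C l) _) ⟩
    (n C k) *ℕ (((n ∸ k) C l) *ℕ (k ! *ℕ (l ! *ℕ m !)))  ≡⟨ ≡.cong (λ z → (n C k) *ℕ (((n ∸ k) C l) *ℕ z)) (ℕ.*-assoc (k !) (l !) (m !)) ⟨
    (n C k) *ℕ (((n ∸ k) C l) *ℕ (k ! *ℕ l ! *ℕ m !))    ≡⟨ ℕ.*-assoc (n C k) _ _ ⟨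
    (n C k) *ℕ ((n ∸ k) C l) *ℕ (k ! *ℕ l ! *ℕ m !)      ∎

-- Weighted finite sums and the commuting algebra of shift operators.

module ShiftOperators {c ℓ : Level} (R : CommutativeRing c ℓ) where
  open CommutativeRing R
  open Algebra.Properties.Ring ring using (-‿distribˡ-*)
  open Algebra.Properties.AbelianGroup +-abelianGroup
    using () renaming (⁻¹-∙-comm to -‿+-comm; ε⁻¹≈ε to -0#≈0#; ⁻¹-involutive to -‿involutive)
  open Algebra.Properties.CommutativeSemigroup *-commutativeSemigroup
    using (x∙yz≈y∙xz; xy∙z≈xz∙y; x∙yz≈xz∙y)
  open Algebra.Properties.CommutativeSemiring.Binomial commutativeSemiring
    using () renaming (theorem to binomial-theorem)
  open Algebra.Properties.CommutativeSemiring.Exp commutativeSemiring using (_^_; ^-congˡ)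
  open Algebra.Properties.Semiring.Mult semiring using (_×_; ×-homo-+; ×-assoc-*; ×-congʳ; ×1-homo-*)
  open Algebra.Properties.Semiring.Sum semiring
  open Relation.Binary.Reasoning.Setoid setoid

  fromℕ : ℕ → Carrier
  fromℕ n = n × 1#

  ×≈fromℕ* : ∀ n x → n × x ≈ fromℕ n * x
  ×≈fromℕ* n x = trans (×-congʳ n (sym (*-identityˡ x))) (sym (×-assoc-* n 1# x))

  -- Fubini with weights. It is behind the commutation of operators, the linearity of `comb` and the
  -- expansion in `comb-pow`.
  *-∑-exchange : ∀ {m n} (a : Fin m → Carrier) (b : Fin n → Carrier) (F : Fin m → Fin n → Carrier) →
    ∑[ i < m ] (a i * ∑[ j < n ] (b j * F i j)) ≈ ∑[ j < n ] (b j * ∑[ i < m ] (a i * F i j))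
  *-∑-exchange {m} {n} a b F = begin
    ∑[ i < m ] (a i * ∑[ j < n ] (b j * F i j))   ≈⟨ sum-cong-≋ (λ i → *-distribˡ-sum (a i) (λ j → b j * F i j)) ⟩
    ∑[ i < m ] ∑[ j < n ] (a i * (b j * F i j))   ≈⟨ ∑-comm (λ i j → a i * (b j * F i j)) ⟩
    ∑[ j < n ] ∑[ i < m ] (a i * (b j * F i j))   ≈⟨ sum-cong-≋ {n} (λ j → sum-cong-≋ {m} (λ i → x∙yz≈y∙xz (a i) (b j) (F i j))) ⟩
    ∑[ j < n ] ∑[ i < m ] (b j * (a i * F i j))   ≈⟨ sum-cong-≋ (λ j → *-distribˡ-sum (b j) (λ i → a i * F i j)) ⟨
    ∑[ j < n ] (b j * ∑[ i < m ] (a i * F i j))   ∎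

  ∑-neg : ∀ {n} (f : Fin n → Carrier) → ∑[ i < n ] (- f i) ≈ - ∑[ i < n ] f i
  ∑-neg {zero}  f = sym -0#≈0#
  ∑-neg {suc n} f = trans (+-congˡ (∑-neg (f ∘ fsuc))) (-‿+-comm _ _)

  ∑-split : ∀ m n (f : ℕ → Carrier) →
    ∑[ i < m ℕ.+ n ] f (toℕ i) ≈ ∑[ i < m ] f (toℕ i) + ∑[ i < n ] f (m ℕ.+ toℕ i)
  ∑-split zero    n f = sym (+-identityˡ _)
  ∑-split (suc m) n f = trans (+-congˡ (∑-split m n (f ∘ suc))) (sym (+-assoc _ _ _))

  -- `comb n a u` stands for the sum of the aᵢ τ^{uᵢ}. Restricting to this syntax makes every
  -- operator commute with every other, which arbitrary maps on functions need not do; a formal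
  -- composition avoids multiplying out coefficients.
  data Op : Set c where
    id   : Op
    _∙_  : Op → Op → Op
    comb : ∀ n → (Fin n → Carrier) → (Fin n → ℕ) → Op

  infixr 7 _∙_

  ⟦_⟧ : Op → (ℕ → Carrier) → ℕ → Carrier
  ⟦ id ⟧         h x = h x
  ⟦ A ∙ B ⟧      h x = ⟦ A ⟧ (⟦ B ⟧ h) x
  ⟦ comb n a u ⟧ h x = ∑[ i < n ] (a i * h (x ℕ.+ u i))

  infix 4 _≋_
  record _≋_ (A B : Op) : Set (c ⊔ ℓ) where
    constructor pointwise
    field
      at : ∀ h x → ⟦ A ⟧ h x ≈ ⟦ B ⟧ h x
  open _≋_ public

  ⟦⟧-cong : ∀ A {f g : ℕ → Carrier} → (∀ x → f x ≈ g x) → ∀ x → ⟦ A ⟧ f x ≈ ⟦ A ⟧ g x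
  ⟦⟧-cong id           f≈g = f≈g
  ⟦⟧-cong (A ∙ B)      f≈g = ⟦⟧-cong A (⟦⟧-cong B f≈g)
  ⟦⟧-cong (comb n a u) f≈g x = sum-cong-≋ (λ i → *-congˡ {a i} (f≈g (x ℕ.+ u i)))

  -- Induction on both terms reduces this to two `comb`s, where exchanging the sums leaves only x +
  -- uᵢ + vⱼ = x + vⱼ + uᵢ inside h.
  ⟦⟧-comm : ∀ A B h x → ⟦ A ⟧ (⟦ B ⟧ h) x ≈ ⟦ B ⟧ (⟦ A ⟧ h) x
  ⟦⟧-comm id       B              h x = refl
  ⟦⟧-comm (A ∙ A′) B              h x = trans (⟦⟧-cong A (⟦⟧-comm A′ B h) x) (⟦⟧-comm A B (⟦ A′ ⟧ h) x)
  ⟦⟧-comm (comb _ _ _) id         h x = refl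
  ⟦⟧-comm A@(comb _ _ _) (B ∙ B′) h x = trans (⟦⟧-comm A B (⟦ B′ ⟧ h) x) (⟦⟧-cong B (⟦⟧-comm A B′ h) x)
  ⟦⟧-comm (comb m a u) (comb n b v) h x = trans
    (*-∑-exchange a b (λ i j → h (x ℕ.+ u i ℕ.+ v j)))
    (sum-cong-≋ (λ j → *-congˡ {b j} (sum-cong-≋ (λ i → *-congˡ {a i} (reflexive (≡.cong h (swap (u i) (v j))))))))
    where
    swap : ∀ y z → x ℕ.+ y ℕ.+ z ≡ x ℕ.+ z ℕ.+ y
    swap = Algebra.Properties.CommutativeSemigroup.xy∙z≈xz∙y ℕ.+-commutativeSemigroup x

  Op-commutativeMonoid : CommutativeMonoid c (c ⊔ ℓ)
  Op-commutativeMonoid = record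
    { Carrier = Op ; _≈_ = _≋_ ; _∙_ = _∙_ ; ε = id
    ; isCommutativeMonoid = record
      { isMonoid = record
        { isSemigroup = record
          { isMagma = record
            { isEquivalence = record
              { refl  = pointwise (λ h x → refl)
              ; sym   = λ p → pointwise (λ h x → sym (p .at h x))
              ; trans = λ p q → pointwise (λ h x → trans (p .at h x) (q .at h x))
              }
            ; ∙-cong = λ {_} {A′} {B} p q → pointwise (λ h x →
                trans (p .at (⟦ B ⟧ h) x) (⟦⟧-cong A′ (q .at h) x))
            }
          ; assoc = λ _ _ _ → pointwise (λ h x → refl)
          }
        ; identity = (λ _ → pointwise (λ h x → refl)) , (λ _ → pointwise (λ h x → refl))
        }
      ; comm = λ A B → pointwise (⟦⟧-comm A B)
      }
    }

  -- The operators 1 + τᵘ and their cancellation.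

  1+τ^ : ℕ → Op
  1+τ^ u = comb 2 (λ _ → 1#) (λ i → toℕ i *ℕ u)

  ⟦1+τ^⟧ : ∀ u h x → ⟦ 1+τ^ u ⟧ h x ≈ h x + h (x ℕ.+ u)
  ⟦1+τ^⟧ u h x = +-cong
    (trans (*-identityˡ _) (reflexive (≡.cong h (ℕ.+-identityʳ x))))
    (trans (+-identityʳ _) (trans (*-identityˡ _)
      (reflexive (≡.cong (λ y → h (x ℕ.+ y)) (ℕ.+-identityʳ u)))))

  Surjective : Op → Set (c ⊔ ℓ)
  Surjective A = ∀ (g : ℕ → Carrier) → ∃[ h ] ∀ x → ⟦ A ⟧ h x ≈ g x

  ∙-surjective : ∀ {A B} → Surjective A → Surjective B → Surjective (A ∙ B)
  ∙-surjective {A} {B} surjA surjB g =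
    let f , Af≈g = surjA g
        h , Bh≈f = surjB f
    in h , λ x → trans (⟦⟧-cong A Bh≈f x) (Af≈g x)

  -- Any g has the form E h, so A g and B g are values of the two equal composites at h. Injectivity
  -- of E could not be used instead: 1 + τᵘ kills every h with h (x + u) = - h x.
  ∙-cancelʳ : ∀ {A B E} → Surjective E → A ∙ E ≋ B ∙ E → A ≋ B
  ∙-cancelʳ {A} {B} surjE AE≋BE = pointwise (λ g x →
    let h , Eh≈g = surjE g
    in trans (sym (⟦⟧-cong A Eh≈g x)) (trans (AE≋BE .at h x) (⟦⟧-cong B Eh≈g x)))

  1+τ^-surjective : ∀ u .{{_ : NonZero u}} → Surjective (1+τ^ u)
  1+τ^-surjective u g = h , λ x → begin
    ⟦ 1+τ^ u ⟧ h x                ≈⟨ ⟦1+τ^⟧ u h x ⟩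
    h x + h (x ℕ.+ u)             ≈⟨ +-congˡ (reflexive (h[x+u] x)) ⟩
    h x + (g (x % u ℕ.+ x / u *ℕ u) - h x) ≈⟨ +-comm _ _ ⟩
    (g (x % u ℕ.+ x / u *ℕ u) - h x) + h x ≈⟨ +-assoc _ _ _ ⟩
    g (x % u ℕ.+ x / u *ℕ u) + (- h x + h x) ≈⟨ +-congˡ (-‿inverseˡ _) ⟩
    g (x % u ℕ.+ x / u *ℕ u) + 0# ≈⟨ +-identityʳ _ ⟩
    g (x % u ℕ.+ x / u *ℕ u)      ≡⟨ ≡.cong g (m≡m%n+[m/n]*n x u) ⟨
    g x                           ∎
    where
    -- h (r + q u), from the recursion h (x + u) = g x - h x with h = 0 on [0 , u).
    H : ℕ → ℕ → Carrier
    H zero    r = 0#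
    H (suc q) r = g (r ℕ.+ q *ℕ u) - H q r
    h : ℕ → Carrier
    h x = H (x / u) (x % u)
    [x+u]/u : ∀ x → (x ℕ.+ u) / u ≡ suc (x / u)
    [x+u]/u x = ≡.trans (m/n≡1+[m∸n]/n (ℕ.m≤n+m u x))
                        (≡.cong (λ y → suc (y / u)) (ℕ.m+n∸n≡m x u))
    h[x+u] : ∀ x → h (x ℕ.+ u) ≡ g (x % u ℕ.+ x / u *ℕ u) - h x
    h[x+u] x = ≡.cong₂ H ([x+u]/u x) ([m+n]%n≡m%n x u)

  -- Action of the operators on powers.

  -- This is the sum of the aᵢ uᵢᵏ. For the operators Λ of the theorem it becomes a power sum `T k`
  -- times a power of the step.
  moment : ∀ n → (Fin n → Carrier) → (Fin n → ℕ) → ℕ → Carrier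
  moment n a u k = ⟦ comb n a u ⟧ (λ y → fromℕ y ^ k) 0

  comb-linear : ∀ {m n} (a : Fin n → Carrier) u (b : Fin m → Carrier) (f : Fin m → ℕ → Carrier) x →
    ⟦ comb n a u ⟧ (λ y → ∑[ j < m ] (b j * f j y)) x ≈ ∑[ j < m ] (b j * ⟦ comb n a u ⟧ (f j) x)
  comb-linear a u b f x = *-∑-exchange a b (λ i j → f j (x ℕ.+ u i))

  -- The binomial theorem is applied to each (x + uᵢ)^N. The index k counts the degree absorbed by
  -- the moment, and the remaining power of x is left for the next operator.
  comb-pow : ∀ n a u N x → ⟦ comb n a u ⟧ (λ y → fromℕ y ^ N) x ≈
    ∑[ k ≤ N ] ((fromℕ (N C toℕ k) * moment n a u (toℕ k)) * fromℕ x ^ (N ∸ toℕ k))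
  comb-pow n a u N x = begin
    ∑[ i < n ] (a i * fromℕ (x ℕ.+ u i) ^ N)
      ≈⟨ sum-cong-≋ {n} (λ i → *-congˡ {a i} (expand (u i))) ⟩
    ∑[ i < n ] (a i * ∑[ k ≤ N ] (b k * fromℕ (u i) ^ toℕ k))
      ≈⟨ *-∑-exchange a b (λ i k → fromℕ (u i) ^ toℕ k) ⟩
    ∑[ k ≤ N ] (b k * moment n a u (toℕ k))
      ≈⟨ sum-cong-≋ {suc N} (λ k → xy∙z≈xz∙y (fromℕ (N C toℕ k)) (fromℕ x ^ (N ∸ toℕ k)) (moment n a u (toℕ k))) ⟩
    ∑[ k ≤ N ] ((fromℕ (N C toℕ k) * moment n a u (toℕ k)) * fromℕ x ^ (N ∸ toℕ k)) ∎
    where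
    b : Fin (suc N) → Carrier
    b k = fromℕ (N C toℕ k) * fromℕ x ^ (N ∸ toℕ k)
    expand : ∀ v → fromℕ (x ℕ.+ v) ^ N ≈ ∑[ k ≤ N ] (b k * fromℕ v ^ toℕ k)
    expand v = begin
      -- The summands are swapped so that the binomial theorem attaches the exponent k to v, not to
      -- x.
      fromℕ (x ℕ.+ v) ^ N        ≈⟨ ^-congˡ N (trans (×-homo-+ 1# x v) (+-comm _ _)) ⟩
      (fromℕ v + fromℕ x) ^ N    ≈⟨ binomial-theorem N (fromℕ v) (fromℕ x) ⟩
      ∑[ k ≤ N ] ((N C toℕ k) × (fromℕ v ^ toℕ k * fromℕ x ^ (N ∸ toℕ k)))
        ≈⟨ sum-cong-≋ {suc N} (λ k → trans (×≈fromℕ* (N C toℕ k) _)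
             (x∙yz≈xz∙y (fromℕ (N C toℕ k)) (fromℕ v ^ toℕ k) (fromℕ x ^ (N ∸ toℕ k)))) ⟩
      ∑[ k ≤ N ] (b k * fromℕ v ^ toℕ k) ∎

  -- The rightmost operator acts first and absorbs degree k, the middle one absorbs l. The last
  -- needs no expansion: its value at 0 on the remaining power is a moment by definition.
  comb³-pow : ∀ n₁ a₁ u₁ n₂ a₂ u₂ n₃ a₃ u₃ N →
    ⟦ comb n₃ a₃ u₃ ∙ comb n₂ a₂ u₂ ∙ comb n₁ a₁ u₁ ⟧ (λ y → fromℕ y ^ N) 0 ≈
    ∑[ k ≤ N ] ∑[ l ≤ N ∸ toℕ k ]
      (fromℕ (multinomial N (toℕ k) (toℕ l) (N ∸ toℕ k ∸ toℕ l))
       * (moment n₁ a₁ u₁ (toℕ k) * (moment n₂ a₂ u₂ (toℕ l) * moment n₃ a₃ u₃ (N ∸ toℕ k ∸ toℕ l))))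
  comb³-pow n₁ a₁ u₁ n₂ a₂ u₂ n₃ a₃ u₃ N = begin
    ⟦ A₃ ∙ A₂ ∙ A₁ ⟧ (pow N) 0
      ≈⟨ ⟦⟧-cong (A₃ ∙ A₂) (comb-pow n₁ a₁ u₁ N) 0 ⟩
    ⟦ A₃ ∙ A₂ ⟧ (λ y → ∑[ k ≤ N ] (b₁ k * pow (N ∸ toℕ k) y)) 0
      ≈⟨ ⟦⟧-cong A₃ (comb-linear a₂ u₂ b₁ (λ k → pow (N ∸ toℕ k))) 0 ⟩
    ⟦ A₃ ⟧ (λ y → ∑[ k ≤ N ] (b₁ k * ⟦ A₂ ⟧ (pow (N ∸ toℕ k)) y)) 0
      ≈⟨ comb-linear a₃ u₃ b₁ (λ k → ⟦ A₂ ⟧ (pow (N ∸ toℕ k))) 0 ⟩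
    ∑[ k ≤ N ] (b₁ k * ⟦ A₃ ∙ A₂ ⟧ (pow (N ∸ toℕ k)) 0)
      ≈⟨ sum-cong-≋ {suc N} inner ⟩
    _ ∎
    where
    A₁ = comb n₁ a₁ u₁
    A₂ = comb n₂ a₂ u₂
    A₃ = comb n₃ a₃ u₃
    m₁ = moment n₁ a₁ u₁
    m₂ = moment n₂ a₂ u₂
    m₃ = moment n₃ a₃ u₃
    pow : ℕ → ℕ → Carrier
    pow j y = fromℕ y ^ j
    b₁ : Fin (suc N) → Carrier
    b₁ k = fromℕ (N C toℕ k) * m₁ (toℕ k)
    inner : ∀ k → b₁ k * ⟦ A₃ ∙ A₂ ⟧ (pow (N ∸ toℕ k)) 0 ≈
      ∑[ l ≤ N ∸ toℕ k ]
        (fromℕ (multinomial N (toℕ k) (toℕ l) (N ∸ toℕ k ∸ toℕ l))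
         * (m₁ (toℕ k) * (m₂ (toℕ l) * m₃ (N ∸ toℕ k ∸ toℕ l))))
    inner k = begin
      b₁ k * ⟦ A₃ ∙ A₂ ⟧ (pow M) 0
        ≈⟨ *-congˡ (⟦⟧-cong A₃ (comb-pow n₂ a₂ u₂ M) 0) ⟩
      b₁ k * ⟦ A₃ ⟧ (λ y → ∑[ l ≤ M ] (b₂ l * pow (M ∸ toℕ l) y)) 0
        ≈⟨ *-congˡ (comb-linear a₃ u₃ b₂ (λ l → pow (M ∸ toℕ l)) 0) ⟩
      b₁ k * ∑[ l ≤ M ] (b₂ l * m₃ (M ∸ toℕ l))
        ≈⟨ *-distribˡ-sum (b₁ k) (λ l → b₂ l * m₃ (M ∸ toℕ l)) ⟩
      ∑[ l ≤ M ] (b₁ k * (b₂ l * m₃ (M ∸ toℕ l)))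
        ≈⟨ sum-cong-≋ {suc M} (λ l → trans
             (regroup (fromℕ (N C toℕ k)) (m₁ (toℕ k)) (fromℕ (M C toℕ l)) (m₂ (toℕ l)) (m₃ (M ∸ toℕ l)))
             (*-congʳ (multinomial-coefficient l))) ⟩
      _ ∎
      where
      M = N ∸ toℕ k
      b₂ : Fin (suc M) → Carrier
      b₂ l = fromℕ (M C toℕ l) * m₂ (toℕ l)
      open Algebra.Solver.CommutativeMonoid *-commutativeMonoid using (solve; _⊜_; _⊕_)
      regroup : ∀ p q r s t → (p * q) * ((r * s) * t) ≈ (p * r) * (q * (s * t))
      regroup = solve 5 (λ p q r s t → (p ⊕ q) ⊕ ((r ⊕ s) ⊕ t) ⊜ (p ⊕ r) ⊕ (q ⊕ (s ⊕ t))) refl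
      multinomial-coefficient : ∀ l → fromℕ (N C toℕ k) * fromℕ (M C toℕ l) ≈
        fromℕ (multinomial N (toℕ k) (toℕ l) (M ∸ toℕ l))
      multinomial-coefficient l = trans (sym (×1-homo-* (N C toℕ k) (M C toℕ l)))
        (reflexive (≡.cong fromℕ (≡.sym (multinomial≡C*C (toℕ≤pred[n] k) (toℕ≤pred[n] l)))))

  -- Sums with antiperiodic weights.

  module _ (ε : ℕ → Carrier) where

    Antiperiod : ℕ → Set ℓ
    Antiperiod m = ∀ x → ε (m ℕ.+ x) ≈ - ε x

    -- Each further pair of steps by m changes the sign twice, so an odd multiple acts like a single
    -- step. It serves both for the lengths wᵢd and for the sign of (-1)^d.
    antiperiod-odd* : ∀ {m w} → Odd w → Antiperiod m → Antiperiod (w *ℕ m)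
    antiperiod-odd* {m} (k , ≡.refl) ε[m+] = go k
      where
      go : ∀ k → Antiperiod ((1 ℕ.+ 2 *ℕ k) *ℕ m)
      go zero    x = trans (reflexive (≡.cong (λ y → ε (y ℕ.+ x)) (ℕ.+-identityʳ m))) (ε[m+] x)
      go (suc k) x = begin
        ε ((1 ℕ.+ 2 *ℕ suc k) *ℕ m ℕ.+ x)            ≡⟨ ≡.cong ε shift ⟩
        ε (m ℕ.+ (m ℕ.+ ((1 ℕ.+ 2 *ℕ k) *ℕ m ℕ.+ x))) ≈⟨ ε[m+] _ ⟩
        - ε (m ℕ.+ ((1 ℕ.+ 2 *ℕ k) *ℕ m ℕ.+ x))       ≈⟨ -‿cong (ε[m+] _) ⟩
        - - ε ((1 ℕ.+ 2 *ℕ k) *ℕ m ℕ.+ x)             ≈⟨ -‿involutive _ ⟩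
        ε ((1 ℕ.+ 2 *ℕ k) *ℕ m ℕ.+ x)                 ≈⟨ go k x ⟩
        - ε x                                         ∎
        where
        shift : (1 ℕ.+ 2 *ℕ suc k) *ℕ m ℕ.+ x ≡ m ℕ.+ (m ℕ.+ ((1 ℕ.+ 2 *ℕ k) *ℕ m ℕ.+ x))
        shift = ≡.trans
          (≡.cong (λ y → (1 ℕ.+ y) *ℕ m ℕ.+ x) (ℕ.*-suc 2 k))
          (≡.trans (ℕ.+-assoc m _ x) (≡.cong (m ℕ.+_) (ℕ.+-assoc m _ x)))

    Λ : ℕ → ℕ → Op
    Λ m s = comb m (ε ∘ toℕ) (λ i → s *ℕ toℕ i)

    -- With G = εF, antiperiodicity turns the left side into the sum of G over [0 , m) minus that
    -- over [n , n + m), and the right side likewise with m and n exchanged. They agree because [0 ,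
    -- m + n) may be cut at m or at n.
    ∑-antiperiod-swap : ∀ {m n} → Antiperiod m → Antiperiod n → ∀ (F : ℕ → Carrier) →
      ∑[ i < m ] (ε (toℕ i) * (F (toℕ i) + F (n ℕ.+ toℕ i))) ≈
      ∑[ i < n ] (ε (toℕ i) * (F (toℕ i) + F (m ℕ.+ toℕ i)))
    ∑-antiperiod-swap {m} {n} ε[m+] ε[n+] F = begin
      ∑[ i < m ] (ε (toℕ i) * (F (toℕ i) + F (n ℕ.+ toℕ i))) ≈⟨ difference m ε[n+] ⟩
      S m 0 - S m n                             ≈⟨ exchange ⟩
      S n 0 - S n m                             ≈⟨ difference n ε[m+] ⟨
      ∑[ i < n ] (ε (toℕ i) * (F (toℕ i) + F (m ℕ.+ toℕ i))) ∎
      where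
      G : ℕ → Carrier
      G x = ε x * F x
      S : ℕ → ℕ → Carrier
      S k x = ∑[ i < k ] G (x ℕ.+ toℕ i)
      difference : ∀ k {l} → Antiperiod l →
        ∑[ i < k ] (ε (toℕ i) * (F (toℕ i) + F (l ℕ.+ toℕ i))) ≈ S k 0 - S k l
      difference k {l} ε[l+] = begin
        ∑[ i < k ] (ε (toℕ i) * (F (toℕ i) + F (l ℕ.+ toℕ i)))
          ≈⟨ sum-cong-≋ {k} (λ i → trans (distribˡ _ _ _) (+-congˡ (sign (toℕ i)))) ⟩
        ∑[ i < k ] (G (toℕ i) - G (l ℕ.+ toℕ i))
          ≈⟨ ∑-distrib-+ {k} (G ∘ toℕ) (λ i → - G (l ℕ.+ toℕ i)) ⟩
        S k 0 + ∑[ i < k ] (- G (l ℕ.+ toℕ i))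
          ≈⟨ +-congˡ (∑-neg {k} (λ i → G (l ℕ.+ toℕ i))) ⟩
        S k 0 - S k l ∎
        where
        sign : ∀ x → ε x * F (l ℕ.+ x) ≈ - G (l ℕ.+ x)
        sign x = begin
          ε x * F (l ℕ.+ x)              ≈⟨ *-congʳ (-‿involutive (ε x)) ⟨
          - - ε x * F (l ℕ.+ x)          ≈⟨ *-congʳ (-‿cong (ε[l+] x)) ⟨
          - ε (l ℕ.+ x) * F (l ℕ.+ x)    ≈⟨ -‿distribˡ-* _ _ ⟨
          - G (l ℕ.+ x)                  ∎
      both-ways : S m 0 + S n m ≈ S n 0 + S m n
      both-ways = begin
        S m 0 + S n m   ≈⟨ ∑-split m n G ⟨
        S (m ℕ.+ n) 0   ≡⟨ ≡.cong (λ k → S k 0) (ℕ.+-comm m n) ⟩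
        S (n ℕ.+ m) 0   ≈⟨ ∑-split n m G ⟩
        S n 0 + S m n   ∎
      exchange : S m 0 - S m n ≈ S n 0 - S n m
      exchange = begin
        -- `S n m` is added and subtracted to complete `S m 0` to the sum over [0 , m + n), which is
        -- then cut the other way.
        S m 0 - S m n                       ≈⟨ insert (S m 0) (S n m) (- S m n) ⟩
        (S m 0 + S n m) + (- S n m - S m n) ≈⟨ +-cong both-ways (+-comm _ _) ⟩
        (S n 0 + S m n) + (- S m n - S n m) ≈⟨ insert (S n 0) (S m n) (- S n m) ⟨
        S n 0 - S n m                       ∎
        where
        insert : ∀ x y z → x + z ≈ (x + y) + (- y + z)
        insert x y z = sym (trans (+-assoc x y _) (+-congˡ (trans (sym (+-assoc y (- y) z))
          (trans (+-congʳ (-‿inverseʳ y)) (+-identityˡ z)))))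

    -- For F i = h (x + s i), a shift of h by s n is a shift of the index by n, so the swap of sums
    -- applies. With m = wd and n = d this is the quotient formula for a geometric sum, cleared of
    -- denominators.
    Λ-1+τ^-swap : ∀ {m n} → Antiperiod m → Antiperiod n → ∀ s →
      Λ m s ∙ 1+τ^ (s *ℕ n) ≋ Λ n s ∙ 1+τ^ (s *ℕ m)
    Λ-1+τ^-swap {m} {n} ε[m+] ε[n+] s = pointwise λ h x → let F i = h (x ℕ.+ s *ℕ i) in begin
      ⟦ Λ m s ∙ 1+τ^ (s *ℕ n) ⟧ h x                            ≈⟨ expand h x m n ⟩
      ∑[ i < m ] (ε (toℕ i) * (F (toℕ i) + F (n ℕ.+ toℕ i)))   ≈⟨ ∑-antiperiod-swap ε[m+] ε[n+] F ⟩
      ∑[ i < n ] (ε (toℕ i) * (F (toℕ i) + F (m ℕ.+ toℕ i)))   ≈⟨ expand h x n m ⟨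
      ⟦ Λ n s ∙ 1+τ^ (s *ℕ m) ⟧ h x                            ∎
      where
      expand : ∀ h x k l → ⟦ Λ k s ∙ 1+τ^ (s *ℕ l) ⟧ h x ≈
        ∑[ i < k ] (ε (toℕ i) * (h (x ℕ.+ s *ℕ toℕ i) + h (x ℕ.+ s *ℕ (l ℕ.+ toℕ i))))
      expand h x k l = sum-cong-≋ {k} (λ i → *-congˡ (trans
        (⟦1+τ^⟧ (s *ℕ l) h (x ℕ.+ s *ℕ toℕ i))
        (+-congˡ (reflexive (≡.cong h (shift (toℕ i)))))))
        where
        shift : ∀ i → x ℕ.+ s *ℕ i ℕ.+ s *ℕ l ≡ x ℕ.+ s *ℕ (l ℕ.+ i)
        shift i = ≡.trans (ℕ.+-assoc x _ _) (≡.cong (x ℕ.+_)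
          (≡.trans (≡.sym (ℕ.*-distribˡ-+ s i l)) (≡.cong (s *ℕ_) (ℕ.+-comm i l))))

-- The symmetry of the triple product.

module AntiperiodicWeight {c ℓ : Level} (R : CommutativeRing c ℓ)
  (ε : ℕ → CommutativeRing.Carrier R) {d : ℕ} {{_ : NonZero d}}
  (ε[d+] : ShiftOperators.Antiperiod R ε d) where
  open ShiftOperators R
  open CommutativeMonoid Op-commutativeMonoid using (refl; reflexive; ∙-cong; setoid)
  open Relation.Binary.Reasoning.Setoid setoid
  open Algebra.Solver.CommutativeMonoid Op-commutativeMonoid using (solve; _⊜_; _⊕_)

  -- The innermost factor, of length w₁d and step w₃, belongs to the index k, the middle one to l
  -- and the outermost to m. Thus exchanging w₂ and w₃ passes from one side of the theorem to the
  -- other.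
  Λ³ : ℕ → ℕ → ℕ → Op
  Λ³ w₁ w₂ w₃ = Λ ε (w₃ *ℕ d) w₂ ∙ Λ ε (w₂ *ℕ d) w₁ ∙ Λ ε (w₁ *ℕ d) w₃

  -- After reduction each `B wᵢ` occurs once, together with one E for each unordered pair of the wᵢ;
  -- E is symmetric since its exponent is the product s w d.
  Λ³-symmetric : ∀ {w₁ w₂ w₃} → .{{_ : NonZero w₁}} → .{{_ : NonZero w₂}} → .{{_ : NonZero w₃}} →
    Odd w₁ → Odd w₂ → Odd w₃ → Λ³ w₁ w₂ w₃ ≋ Λ³ w₁ w₃ w₂
  Λ³-symmetric {w₁} {w₂} {w₃} odd₁ odd₂ odd₃ = ∙-cancelʳ surjective (begin
    Λ³ w₁ w₂ w₃ ∙ D w₁ ∙ D w₂ ∙ D w₃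
      -- Each Λ is paired with the D of its step, not of its length, as `reduce` requires.
      ≈⟨ solve 6 (λ a b c x y z → (a ⊕ (b ⊕ c)) ⊕ (x ⊕ (y ⊕ z)) ⊜ (a ⊕ y) ⊕ ((b ⊕ x) ⊕ (c ⊕ z)))
           refl (Λ ε (w₃ *ℕ d) w₂) (Λ ε (w₂ *ℕ d) w₁) (Λ ε (w₁ *ℕ d) w₃) (D w₁) (D w₂) (D w₃) ⟩
    (Λ ε (w₃ *ℕ d) w₂ ∙ D w₂) ∙ (Λ ε (w₂ *ℕ d) w₁ ∙ D w₁) ∙ (Λ ε (w₁ *ℕ d) w₃ ∙ D w₃)
      ≈⟨ ∙-cong (reduce odd₃ w₂) (∙-cong (reduce odd₂ w₁) (reduce odd₁ w₃)) ⟩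
    (B w₂ ∙ E w₂ w₃) ∙ (B w₁ ∙ E w₁ w₂) ∙ (B w₃ ∙ E w₃ w₁)
      -- Each B receives the E it has on the exchanged side, up to the order of the two arguments.
      ≈⟨ solve 6 (λ a b c x y z → (a ⊕ x) ⊕ ((b ⊕ y) ⊕ (c ⊕ z)) ⊜ (c ⊕ x) ⊕ ((b ⊕ z) ⊕ (a ⊕ y)))
           refl (B w₂) (B w₁) (B w₃) (E w₂ w₃) (E w₁ w₂) (E w₃ w₁) ⟩
    (B w₃ ∙ E w₂ w₃) ∙ (B w₁ ∙ E w₃ w₁) ∙ (B w₂ ∙ E w₁ w₂)
      ≈⟨ ∙-cong (∙-cong refl (E-comm w₂ w₃))
           (∙-cong (∙-cong refl (E-comm w₃ w₁)) (∙-cong refl (E-comm w₁ w₂))) ⟩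
    (B w₃ ∙ E w₃ w₂) ∙ (B w₁ ∙ E w₁ w₃) ∙ (B w₂ ∙ E w₂ w₁)
      ≈⟨ ∙-cong (reduce odd₂ w₃) (∙-cong (reduce odd₃ w₁) (reduce odd₁ w₂)) ⟨
    (Λ ε (w₂ *ℕ d) w₃ ∙ D w₃) ∙ (Λ ε (w₃ *ℕ d) w₁ ∙ D w₁) ∙ (Λ ε (w₁ *ℕ d) w₂ ∙ D w₂)
      ≈⟨ solve 6 (λ a b c x y z → (a ⊕ z) ⊕ ((b ⊕ x) ⊕ (c ⊕ y)) ⊜ (a ⊕ (b ⊕ c)) ⊕ (x ⊕ (y ⊕ z)))
           refl (Λ ε (w₂ *ℕ d) w₃) (Λ ε (w₃ *ℕ d) w₁) (Λ ε (w₁ *ℕ d) w₂) (D w₁) (D w₂) (D w₃) ⟩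
    Λ³ w₁ w₃ w₂ ∙ D w₁ ∙ D w₂ ∙ D w₃ ∎)
    where
    B D : ℕ → Op
    B s = Λ ε d s
    D s = 1+τ^ (s *ℕ d)
    E : ℕ → ℕ → Op
    E s w = 1+τ^ (s *ℕ (w *ℕ d))
    reduce : ∀ {w} → Odd w → ∀ s → Λ ε (w *ℕ d) s ∙ D s ≋ B s ∙ E s w
    reduce odd s = Λ-1+τ^-swap ε (antiperiod-odd* ε odd ε[d+]) ε[d+] s
    E-comm : ∀ s w → E s w ≋ E w s
    E-comm s w = reflexive (≡.cong 1+τ^ (swap s w d))
      where swap = Algebra.Properties.CommutativeSemigroup.x∙yz≈y∙xz ℕ.*-commutativeSemigroup
    D-surjective : ∀ w .{{_ : NonZero w}} → Surjective (D w)
    D-surjective w = 1+τ^-surjective (w *ℕ d) {{m*n≢0 w d}}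
    surjective : Surjective (D w₁ ∙ D w₂ ∙ D w₃)
    surjective = ∙-surjective {D w₁} {D w₂ ∙ D w₃} (D-surjective w₁)
      (∙-surjective {D w₂} {D w₃} (D-surjective w₂) (D-surjective w₃))

-- Specialisation to the weight given by the alternating sign and the character.

theorem4p8 : ∀ {a b₁ b₂ c ℓ₁ ℓ₂ : Level}
    (p : ℕ) → Prime p → Odd p →
    (ℚ̄ : AlgebraicClosureOfℚ a b₁ b₂) (Cₚ : ℂₚ p c ℓ₁ ℓ₂) (ι : Embedding ℚ̄ Cₚ)
    (d : ℕ) → Odd d →
    (χ : PrimitiveDirichletCharacter (AlgebraicClosureOfℚ.heytingField ℚ̄) d)
    (w₁ w₂ w₃ : ℕ) → Odd w₁ → Odd w₂ → Odd w₃ →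
    (n : ℕ) →
    let open PowerSums ℚ̄ Cₚ ι χ in
    ∑₃ n (λ k l m →
    fromℕ (multinomial n k l m)
    * T k (w₁ *ℕ d ∸ 1) * T l (w₂ *ℕ d ∸ 1) * T m (w₃ *ℕ d ∸ 1)
    * fromℕ w₃ ^ k * fromℕ w₁ ^ l * fromℕ w₂ ^ m)
    ≈
    ∑₃ n (λ k l m →
    fromℕ (multinomial n k l m)
    * T k (w₁ *ℕ d ∸ 1) * T l (w₃ *ℕ d ∸ 1) * T m (w₂ *ℕ d ∸ 1)
    * fromℕ w₂ ^ k * fromℕ w₁ ^ l * fromℕ w₃ ^ m)
theorem4p8 p _ _ ℚ̄ Cₚ ι d odd-d X w₁ w₂ w₃ odd₁ odd₂ odd₃ n = begin
  _                                       ≈⟨ ∑₃≈Λ³ w₁ w₂ w₃ ⟨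
  ⟦ Λ³ ε ε[d+] w₁ w₂ w₃ ⟧ (λ y → fromℕ y ^ n) 0  ≈⟨ Λ³-symmetric ε ε[d+] odd₁ odd₂ odd₃ .at (λ y → fromℕ y ^ n) 0 ⟩
  ⟦ Λ³ ε ε[d+] w₁ w₃ w₂ ⟧ (λ y → fromℕ y ^ n) 0  ≈⟨ ∑₃≈Λ³ w₁ w₃ w₂ ⟩
  _                                       ∎
  where
  module Cp = ℂₚ Cₚ
  open CommutativeRing Cp.commutativeRing
  open Embedding ι using (isRingMonomorphism) renaming (⟦_⟧ to ι⟦_⟧)
  open PrimitiveDirichletCharacter X using (χ; χ-periodic)
  open PowerSums ℚ̄ Cₚ ι X using (T; ∑₃; _^_)
  open ShiftOperators Cp.commutativeRing
  open Algebra.Properties.CommutativeSemiring.Exp commutativeSemiring using (^-congˡ; ^-distrib-*)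
  open Algebra.Properties.Ring ring using (-1*x≈-x; -‿distribˡ-*)
  open Algebra.Properties.Semiring.Mult semiring using (×1-homo-*)
  open Algebra.Properties.Semiring.Sum semiring
  open AntiperiodicWeight Cp.commutativeRing
  open Relation.Binary.Reasoning.Setoid setoid

  ε : ℕ → Carrier
  ε x = (- 1#) ^ x * ι⟦ χ (+ x) ⟧

  ε[d+] : Antiperiod ε d
  ε[d+] x = begin
    (- 1#) ^ (d ℕ.+ x) * ι⟦ χ (+ (d ℕ.+ x)) ⟧
      ≈⟨ *-cong (sign x) (trans (reflexive (≡.cong (λ y → ι⟦ χ (+ y) ⟧) (ℕ.+-comm d x)))
           (IsRingMonomorphism.⟦⟧-cong isRingMonomorphism (χ-periodic (+ x)))) ⟩
    - (- 1#) ^ x * ι⟦ χ (+ x) ⟧    ≈⟨ -‿distribˡ-* _ _ ⟨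
    - ε x                          ∎
    where
    -- The powers of -1 have antiperiod 1, hence also its odd multiple `d *ℕ 1`.
    sign : Antiperiod ((- 1#) ^_) d
    sign = ≡.subst (Antiperiod ((- 1#) ^_)) (ℕ.*-identityʳ d)
      (antiperiod-odd* _ odd-d (λ y → -1*x≈-x _))

  odd⇒nonZero : ∀ {m} → Odd m → NonZero m
  odd⇒nonZero (_ , ≡.refl) = _

  instance
    d≢0 : NonZero d
    d≢0 = odd⇒nonZero odd-d
    w₁≢0 : NonZero w₁
    w₁≢0 = odd⇒nonZero odd₁
    w₂≢0 : NonZero w₂
    w₂≢0 = odd⇒nonZero odd₂
    w₃≢0 : NonZero w₃
    w₃≢0 = odd⇒nonZero odd₃

  -- The factor sᵏ comes out of (s i)ᵏ. Positivity of m matters: for m = 0 the moment is an empty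
  -- sum, while truncated subtraction would leave the term i = 0 in `T`.
  moment-Λ : ∀ m .{{_ : NonZero m}} s k →
    moment m (ε ∘ toℕ) (λ i → s *ℕ toℕ i) k ≈ T k (m ∸ 1) * fromℕ s ^ k
  moment-Λ m@(suc _) s k = begin
    ∑[ i < m ] (ε (toℕ i) * fromℕ (s *ℕ toℕ i) ^ k)
      ≈⟨ sum-cong-≋ {m} (λ i → trans (*-congˡ {ε (toℕ i)} (split (toℕ i))) (sym (*-assoc (ε (toℕ i)) _ _))) ⟩
    ∑[ i < m ] (ε (toℕ i) * fromℕ (toℕ i) ^ k * fromℕ s ^ k)
      ≈⟨ *-distribʳ-sum {m} (fromℕ s ^ k) (λ i → ε (toℕ i) * fromℕ (toℕ i) ^ k) ⟨
    T k (m ∸ 1) * fromℕ s ^ k ∎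
    where
    split : ∀ i → fromℕ (s *ℕ i) ^ k ≈ fromℕ i ^ k * fromℕ s ^ k
    split i = trans (^-congˡ k (×1-homo-* s i)) (trans (^-distrib-* _ _ k) (*-comm _ _))

  -- The three weights are quantified afresh so that both sides of the theorem are instances, the
  -- second with w₂ and w₃ exchanged.
  ∑₃≈Λ³ : ∀ w₁ w₂ w₃ .{{_ : NonZero w₁}} .{{_ : NonZero w₂}} .{{_ : NonZero w₃}} →
    ⟦ Λ³ ε ε[d+] w₁ w₂ w₃ ⟧ (λ y → fromℕ y ^ n) 0 ≈
    ∑₃ n (λ k l m →
      fromℕ (multinomial n k l m)
      * T k (w₁ *ℕ d ∸ 1) * T l (w₂ *ℕ d ∸ 1) * T m (w₃ *ℕ d ∸ 1)
      * fromℕ w₃ ^ k * fromℕ w₁ ^ l * fromℕ w₂ ^ m)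
  ∑₃≈Λ³ w₁ w₂ w₃ = trans
    (comb³-pow (w₁ *ℕ d) (ε ∘ toℕ) (λ i → w₃ *ℕ toℕ i) (w₂ *ℕ d) (ε ∘ toℕ) (λ i → w₁ *ℕ toℕ i)
      (w₃ *ℕ d) (ε ∘ toℕ) (λ i → w₂ *ℕ toℕ i) n)
    (sum-cong-≋ {suc n} (λ k → sum-cong-≋ {suc (n ∸ toℕ k)} (λ l → trans
      (*-congˡ (*-cong (moment-Λ (w₁ *ℕ d) w₃ (toℕ k))
        (*-cong (moment-Λ (w₂ *ℕ d) w₁ (toℕ l)) (moment-Λ (w₃ *ℕ d) w₂ (n ∸ toℕ k ∸ toℕ l)))))
      (regroup (fromℕ (multinomial n (toℕ k) (toℕ l) (n ∸ toℕ k ∸ toℕ l)))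
        (T (toℕ k) (w₁ *ℕ d ∸ 1)) (T (toℕ l) (w₂ *ℕ d ∸ 1)) (T (n ∸ toℕ k ∸ toℕ l) (w₃ *ℕ d ∸ 1))
        (fromℕ w₃ ^ toℕ k) (fromℕ w₁ ^ toℕ l) (fromℕ w₂ ^ (n ∸ toℕ k ∸ toℕ l))))))
    where
    instance
      _ = m*n≢0 w₁ d
      _ = m*n≢0 w₂ d
      _ = m*n≢0 w₃ d
    open Algebra.Solver.CommutativeMonoid *-commutativeMonoid using (solve; _⊜_; _⊕_)
    regroup : ∀ q r s t x y z → q * ((r * x) * ((s * y) * (t * z))) ≈ q * r * s * t * x * y * z
    regroup = solve 7 (λ q r s t x y z →
      q ⊕ ((r ⊕ x) ⊕ ((s ⊕ y) ⊕ (t ⊕ z))) ⊜ (((((q ⊕ r) ⊕ s) ⊕ t) ⊕ x) ⊕ y) ⊕ z) refl
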